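{- Let $0<\alpha<1/2$ be fixed. For a positive integer $n$, let $D_\alpha(n)$ be the number of distinct distances determined by pairs of points of the rectangular lattice $$R_\alpha(n)=\{(i,j)\in\mathbb{Z}^2 \mid 0\le i\le n^{1-\alpha},\ 0\le j\le n^{\alpha}\}.$$ Then $D_\alpha(n)=\Theta(n)$ as $n\to\infty$; that is, there exist constants $c,C>0$ and $n_0$ (which may depend on $\alpha$) such that $c\,n\le D_\alpha(n)\le C\,n$ for all $n\ge n_0$.
   Context: Distances are Euclidean distances in the plane. The number of distinct distances determined by a finite point set $\mathcal{P}\subset\mathbb{R}^2$ is the number of distinct nonzero values $|pq|$ with $p,q\in\mathcal{P}$. -}

module Defs where

open import Level using (0ℓ) renaming (suc to lsuc)
open import Data.Nat as ℕ using (ℕ)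
open import Data.Integer as ℤ using (ℤ; +_; 0ℤ; ∣_∣)
open import Data.Rational as ℚ using (ℚ; 0ℚ; 1ℚ; _/_)
import Data.Rational.Properties as ℚ
import Algebra.Properties.AbelianGroup ℚ.+-0-abelianGroup as ℚ+
open import Data.Product using (∃; ∃-syntax; Σ-syntax; _×_; _,_)
open import Data.Sum using (_⊎_; inj₁; inj₂; swap)
open import Data.List using (List; length)
import Data.List.Membership.Setoid as Membership
import Data.List.Relation.Unary.Unique.Setoid as UniqueSetoid
open import Function using (_⇔_)
open import Function.Properties.Equivalence using (⇔-isEquivalence)
open import Relation.Binary using (Setoid; IsEquivalence)
open import Relation.Binary.PropositionalEquality using (_≡_; refl; sym; trans; cong; subst)
open import Relation.Nullary using (¬_; yes; no)
open import Relation.Unary using (Pred)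

-- Dedekind reals: L q is "q < x" and U q is "x < q".
record ℝ : Set₁ where
  field
    L U         : Pred ℚ 0ℓ
    L-inhabited : ∃ L
    U-inhabited : ∃ U
    L-down      : ∀ {q r} → q ℚ.< r → L r → L q
    U-up        : ∀ {q r} → q ℚ.< r → U q → U r
    L-open      : ∀ {q} → L q → ∃[ r ] q ℚ.< r × L r
    U-open      : ∀ {r} → U r → ∃[ q ] q ℚ.< r × U q
    disjoint    : ∀ {q} → ¬ (L q × U q)
    located     : ∀ {q r} → q ℚ.< r → L q ⊎ U r

open ℝ

infix 4 _≈ᴿ_ _<ᴿ_

-- The lower cut of a located real determines its upper cut.
_≈ᴿ_ : ℝ → ℝ → Set
x ≈ᴿ y = ∀ q → L x q ⇔ L y q

_<ᴿ_ : ℝ → ℝ → Set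
x <ᴿ y = ∃[ q ] U x q × L y q

ℝ-setoid : Setoid (lsuc 0ℓ) 0ℓ
ℝ-setoid = record
  { Carrier       = ℝ
  ; _≈_           = _≈ᴿ_
  ; isEquivalence = record
    { refl  = λ q → E.refl
    ; sym   = λ x≈y q → E.sym (x≈y q)
    ; trans = λ x≈y y≈z q → E.trans (x≈y q) (y≈z q)
    }
  }
  where module E {ℓ} = IsEquivalence (⇔-isEquivalence {ℓ})

private
  pred<  : ∀ q → q ℚ.- 1ℚ ℚ.< q
  pred< q = subst (q ℚ.- 1ℚ ℚ.<_) (ℚ.+-identityʳ q) (ℚ.+-monoʳ-< q (ℚ.negative⁻¹ _))

  <suc : ∀ q → q ℚ.< q ℚ.+ 1ℚ
  <suc q = subst (ℚ._< q ℚ.+ 1ℚ) (ℚ.+-identityʳ q) (ℚ.+-monoʳ-< q (ℚ.positive⁻¹ _))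

fromℚ : ℚ → ℝ
fromℚ a = record
  { L           = ℚ._< a
  ; U           = a ℚ.<_
  ; L-inhabited = a ℚ.- 1ℚ , pred< a
  ; U-inhabited = a ℚ.+ 1ℚ , <suc a
  ; L-down      = ℚ.<-trans
  ; U-up        = λ q<r a<q → ℚ.<-trans a<q q<r
  ; L-open      = λ q<a → let r , q<r , r<a = ℚ.<-dense q<a in r , q<r , r<a
  ; U-open      = λ a<r → let q , a<q , q<r = ℚ.<-dense a<r in q , q<r , a<q
  ; disjoint    = λ (q<a , a<q) → ℚ.<-asym q<a a<q
  ; located     = λ {q} q<r → loc q q<r
  }
  where
  loc : ∀ q {r} → q ℚ.< r → q ℚ.< a ⊎ a ℚ.< r
  loc q q<r with q ℚ.<? a
  ... | yes q<a = inj₁ q<a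
  ... | no  q≮a = inj₂ (ℚ.≤-<-trans (ℚ.≮⇒≥ q≮a) q<r)

infixl 6 _-ᴿ_

-- a -ᴿ x is a - x for a rational a: q < a - x iff x < a - q.
_-ᴿ_ : ℚ → ℝ → ℝ
a -ᴿ x = record
  { L           = λ q → U x (a ℚ.- q)
  ; U           = λ q → L x (a ℚ.- q)
  ; L-inhabited = let q , Uq = U-inhabited x in a ℚ.- q , subst (U x) (sym (a-[a-q] q)) Uq
  ; U-inhabited = let q , Lq = L-inhabited x in a ℚ.- q , subst (L x) (sym (a-[a-q] q)) Lq
  ; L-down      = λ q<r → U-up x (flip< q<r)
  ; U-up        = λ q<r → L-down x (flip< q<r)
  ; L-open      = λ {q} Uaq → let s , s< , Us = U-open x Uaq in
                    a ℚ.- s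
                    , subst (ℚ._< a ℚ.- s) (a-[a-q] q) (flip< s<)
                    , subst (U x) (sym (a-[a-q] s)) Us
  ; U-open      = λ {r} Lar → let s , <s , Ls = L-open x Lar in
                    a ℚ.- s
                    , subst (a ℚ.- s ℚ.<_) (a-[a-q] r) (flip< <s)
                    , subst (L x) (sym (a-[a-q] s)) Ls
  ; disjoint    = λ (u , l) → disjoint x (l , u)
  ; located     = λ q<r → swap (located x (flip< q<r))
  }
  where
  flip< : ∀ {q r} → q ℚ.< r → a ℚ.- r ℚ.< a ℚ.- q
  flip< q<r = ℚ.+-monoʳ-< a (ℚ.neg-antimono-< q<r)

  a-[a-q] : ∀ q → a ℚ.- (a ℚ.- q) ≡ q
  a-[a-q] q = trans (cong (a ℚ.+_) (trans (ℚ.neg-distrib-+ a (ℚ.- q))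
                      (cong (ℚ.- a ℚ.+_) (ℚ+.⁻¹-involutive q))))
              (trans (sym (ℚ.+-assoc a (ℚ.- a) q))
              (trans (cong (ℚ._+ q) (ℚ.+-inverseʳ a)) (ℚ.+-identityˡ q)))

fromℕ : ℕ → ℚ
fromℕ n = + n / 1

private
  0≤fromℕ : ∀ m → 0ℚ ℚ.≤ fromℕ m
  0≤fromℕ m = ℚ.nonNegative⁻¹ (fromℕ m) {{ℚ.normalize-nonNeg m 1}}

  sq-mono-< : ∀ {q r} → 0ℚ ℚ.≤ q → q ℚ.< r → q ℚ.* q ℚ.< r ℚ.* r
  sq-mono-< {q} {r} 0≤q q<r = ℚ.≤-<-trans
    (ℚ.*-monoˡ-≤-nonNeg q {{ℚ.nonNegative 0≤q}} (ℚ.<⇒≤ q<r))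
    (ℚ.*-monoˡ-<-pos r {{ℚ.positive (ℚ.≤-<-trans 0≤q q<r)}} q<r)

  ≤-sq : ∀ {a} → 0ℚ ℚ.≤ a → a ℚ.≤ (a ℚ.+ 1ℚ) ℚ.* (a ℚ.+ 1ℚ)
  ≤-sq {a} 0≤a = ℚ.≤-trans (ℚ.<⇒≤ (<suc a)) (subst (ℚ._≤ b ℚ.* b) (ℚ.*-identityʳ b)
    (ℚ.*-monoˡ-≤-nonNeg b {{ℚ.nonNegative 0≤b}} 1≤b))
    where
    b = a ℚ.+ 1ℚ
    0≤b : 0ℚ ℚ.≤ b
    0≤b = ℚ.≤-trans 0≤a (ℚ.<⇒≤ (<suc a))
    1≤b : 1ℚ ℚ.≤ b
    1≤b = subst (ℚ._≤ b) (ℚ.+-identityˡ 1ℚ) (ℚ.+-monoˡ-≤ 1ℚ 0≤a)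

√ : ℕ → ℝ
√ m = record
  { L           = λ q → ∃[ r ] q ℚ.< r × r ℚ.* r ℚ.≤ a
  ; U           = λ q → ∃[ r ] r ℚ.< q × 0ℚ ℚ.≤ r × a ℚ.≤ r ℚ.* r
  ; L-inhabited = 0ℚ ℚ.- 1ℚ , 0ℚ , pred< 0ℚ , 0≤a
  ; U-inhabited = a ℚ.+ 1ℚ ℚ.+ 1ℚ , a ℚ.+ 1ℚ , <suc (a ℚ.+ 1ℚ)
                  , ℚ.≤-trans 0≤a (ℚ.<⇒≤ (<suc a)) , ≤-sq 0≤a
  ; L-down      = λ q<r (s , r<s , h) → s , ℚ.<-trans q<r r<s , h
  ; U-up        = λ q<r (s , s<q , h) → s , ℚ.<-trans s<q q<r , h
  ; L-open      = λ (s , q<s , h) → let t , q<t , t<s = ℚ.<-dense q<s in t , q<t , s , t<s , h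
  ; U-open      = λ (s , s<r , h) → let t , s<t , t<r = ℚ.<-dense s<r in t , t<r , s , s<t , h
  ; disjoint    = λ ((r , q<r , r²≤a) , (s , s<q , 0≤s , a≤s²)) →
                    ℚ.<-irrefl refl (ℚ.<-≤-trans
                      (sq-mono-< 0≤s (ℚ.<-trans s<q q<r)) (ℚ.≤-trans r²≤a a≤s²))
  ; located     = λ q<r → let s , q<s , s<r = ℚ.<-dense q<r in loc q<s s<r
  }
  where
  a = fromℕ m
  0≤a : 0ℚ ℚ.≤ a
  0≤a = 0≤fromℕ m

  loc : ∀ {q s r} → q ℚ.< s → s ℚ.< r →
        (∃[ t ] q ℚ.< t × t ℚ.* t ℚ.≤ a) ⊎ (∃[ t ] t ℚ.< r × 0ℚ ℚ.≤ t × a ℚ.≤ t ℚ.* t)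
  loc {s = s} q<s s<r with s ℚ.<? 0ℚ | s ℚ.* s ℚ.≤? a
  ... | yes s<0 | _       = inj₁ (0ℚ , ℚ.<-trans q<s s<0 , 0≤a)
  ... | no  _   | yes s²≤a = inj₁ (s , q<s , s²≤a)
  ... | no  s≮0 | no  s²≰a = inj₂ (s , s<r , ℚ.≮⇒≥ s≮0 , ℚ.<⇒≤ (ℚ.≰⇒> s²≰a))

-- i ≤ n ^ x, for i ≥ 0, n ≥ 1 and a real exponent x ≥ 0, where
-- n ^ x = inf { n ^ (p / q) : p / q > x } and i ≤ n ^ (p / q) iff i ^ q ≤ n ^ p.
infix 4 _≤_^ᴿ_

_≤_^ᴿ_ : ℤ → ℕ → ℝ → Set
i ≤ n ^ᴿ x = ∀ p q .{{_ : ℕ.NonZero q}} → x <ᴿ fromℚ (+ p / q) → i ℤ.^ q ℤ.≤ + (n ℕ.^ p)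

Point : Set
Point = ℤ × ℤ

dist : Point → Point → ℝ
dist (i , j) (k , l) = √ (∣ i ℤ.- k ∣ ℕ.^ 2 ℕ.+ ∣ j ℤ.- l ∣ ℕ.^ 2)

Lattice : ℝ → ℕ → Pred Point 0ℓ
Lattice α n (i , j) =
  (0ℤ ℤ.≤ i × i ≤ n ^ᴿ (1ℚ -ᴿ α)) × (0ℤ ℤ.≤ j × j ≤ n ^ᴿ α)

IsNonzeroDistance : Pred Point 0ℓ → Pred ℝ 0ℓ
IsNonzeroDistance P d =
  ¬ (d ≈ᴿ fromℚ 0ℚ) × ∃[ a ] ∃[ b ] P a × P b × d ≈ᴿ dist a b

open Membership ℝ-setoid using (_∈_)
open UniqueSetoid ℝ-setoid using (Unique)

-- "P determines exactly D distinct distances".  This is a relation because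
-- membership in Lattice α n is not decidable for a general real α, so D is not
-- computable from P.
DistinctDistances : Pred Point 0ℓ → ℕ → Set₁
DistinctDistances P D =
  Σ[ ds ∈ List ℝ ] Unique ds × (∀ d → d ∈ ds ⇔ IsNonzeroDistance P d) × length ds ≡ D

{-# OPTIONS --safe #-}

-- Let A and B be the largest integers with A ≤ n^(1-α) and B ≤ n^α.  Every nonzero distance is √ (x² + y²)
-- with x ≤ A and y ≤ B, and A B is of order n, so there are O(n) distances.
--
-- For the lower bound, call a point (x , y) with 1 ≤ x ≤ A and 1 ≤ y ≤ B bad if x² + y² = x'² + y'² for such a
-- point with x' < x; points that are not bad have distinct norms.  A collision reads a b = c d with a = x - x',
-- b = x + x', c = y' - y, d = y' + y, hence a = s t, b = u v, c = s u, d = t v with s u and t v at most 2 B.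
-- There are O(B log B) pairs with product at most 2 B, so O(B² log² B) bad points, and this is at most A B / 2
-- for large n because A / B exceeds a positive power of n when α < 1/2.
--
-- A and B are not computable from α, but the bounds on D are decidable, so A and B may be taken under ¬¬.
module Submission where

open import Defs
open import Data.Empty using (⊥)
open import Data.Fin using (zero; suc)
import Data.Fin.Properties as Fin
open import Data.Integer as ℤ using (-[1+_]; +≤+; 0ℤ; ∣_∣) renaming (+_ to pos)
import Data.Integer.Properties as ℤ
open import Data.List using (List; []; _∷_; length; map; upTo; lookup; filter; cartesianProductWith; _++_; deduplicate)
open import Data.List.Membership.Propositional using (_∈_; lose; find)
open import Data.List.Membership.Propositional.Properties
import Data.List.Membership.Setoid as SetoidMembership
import Data.List.Membership.Setoid.Properties as SetoidMembershipₚ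
open import Data.List.Properties using (length-map; length-upTo; length-++; length-filter)
import Data.List.Relation.Unary.All as All
open import Data.List.Relation.Unary.AllPairs using (_∷_)
open import Data.List.Relation.Unary.Any using (Any; any?)
import Data.List.Relation.Unary.Unique.DecPropositional.Properties as UniqueDec
open import Data.List.Relation.Unary.Unique.Propositional using (Unique)
import Data.List.Relation.Unary.Unique.Propositional.Properties as Unique
import Data.List.Relation.Unary.Unique.Setoid as UniqueSetoid
import Data.List.Relation.Unary.Unique.Setoid.Properties as UniqueSetoidₚ
open import Data.Nat as ℕ
open import Data.Nat.Coprimality using (coprime-/gcd; coprime-divisor)
open import Data.Nat.Divisibility using (_∣_; divides; divides-refl)
open import Data.Nat.DivMod
open import Data.Nat.GCD using (gcd; gcd[m,n]∣m; gcd[m,n]∣n; gcd[m,n]≢0)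
open import Data.Nat.Properties
open import Data.Nat.Tactic.RingSolver using (solve-∀)
open import Data.Product hiding (map)
open import Data.Rational as ℚ using (ℚ; 0ℚ; 1ℚ; ½; mkℚ; *<*)
import Data.Rational.Properties as ℚ
open import Data.Rational.Solver using (module +-*-Solver)
open import Data.Rational.Unnormalised as ℚᵘ using (mkℚᵘ)
import Data.Rational.Unnormalised.Properties as ℚᵘ
open import Data.Sum using (inj₁; inj₂)
open import Function using (id; _∘_; _$_; mk⇔; Equivalence)
open import Relation.Binary using (Setoid; tri<; tri≈; tri>)
open import Relation.Binary.PropositionalEquality
open import Relation.Nullary using (¬_; yes; no; contradiction; ¬?; _×-dec_)
open import Relation.Nullary.Decidable using (decidable-stable)
open import Relation.Unary using (Pred; Decidable)

open ℝ
private
  module ≈ᴿ = Setoid ℝ-setoid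
  open SetoidMembership ℝ-setoid using () renaming (_∈_ to _∈ᴿ_)

-- Injections and lengths of lists

module _ {a ℓ} (S : Setoid a ℓ) where
  open Setoid S using (_≈_) renaming (sym to ≈-sym)
  open UniqueSetoid S using () renaming (Unique to Unique₁)

  lookup-injective : ∀ {xs} → Unique₁ xs → ∀ {i j} → lookup xs i ≈ lookup xs j → i ≡ j
  lookup-injective (_ ∷ _) {zero} {zero} _ = refl
  lookup-injective {_ ∷ xs} (x∉ ∷ _) {zero} {suc j} eq = contradiction eq (All.lookup x∉ (∈-lookup j))
  lookup-injective {_ ∷ xs} (x∉ ∷ _) {suc i} {zero} eq = contradiction (≈-sym eq) (All.lookup x∉ (∈-lookup i))
  lookup-injective (_ ∷ xs!) {suc i} {suc j} eq = cong suc (lookup-injective xs! eq)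

module _ {a b ℓ₁ ℓ₂} (S : Setoid a ℓ₁) (T : Setoid b ℓ₂) where
  open Setoid S using () renaming (_≈_ to _≈₁_)
  open Setoid T using () renaming (_≈_ to _≈₂_)
  open UniqueSetoid S using () renaming (Unique to Unique₁)
  open SetoidMembership S using () renaming (_∈_ to _∈₁_)
  open SetoidMembership T using () renaming (_∈_ to _∈₂_)

  -- Sending the position of `x` in `xs` to the position of `f x` in `ys` is an injection of finite
  -- sets. The setoids let the same argument count reals up to `_≈ᴿ_`.
  length-mono-injective : ∀ {xs ys} (f : Setoid.Carrier S → Setoid.Carrier T) → Unique₁ xs →
    (∀ {x} → x ∈₁ xs → f x ∈₂ ys) → (∀ {x y} → x ∈₁ xs → y ∈₁ xs → f x ≈₂ f y → x ≈₁ y) →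
    length xs ≤ length ys
  length-mono-injective {xs} f xs! f∈ f-inj = Fin.injective⇒≤ λ {i} {j} eq →
    lookup-injective S xs! (f-inj (∈-nth i) (∈-nth j)
      (SetoidMembershipₚ.index-injective T (f∈ (∈-nth i)) (f∈ (∈-nth j)) eq))
    where ∈-nth = SetoidMembershipₚ.∈-lookup S xs

length-cartesianProductWith : ∀ {a b c} {A : Set a} {B : Set b} {C : Set c} (f : A → B → C) xs ys →
  length (cartesianProductWith f xs ys) ≡ length xs * length ys
length-cartesianProductWith f []       ys = refl
length-cartesianProductWith f (x ∷ xs) ys = begin
  length (map (f x) ys ++ cartesianProductWith f xs ys)
    ≡⟨ length-++ (map (f x) ys) ⟩
  length (map (f x) ys) + length (cartesianProductWith f xs ys)
    ≡⟨ cong₂ _+_ (length-map (f x) ys) (length-cartesianProductWith f xs ys) ⟩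
  length ys + length xs * length ys ∎
  where open ≡-Reasoning

-- Counting collisions

-- The binary length j of s and the number w = (s − 2 ^ j) + 2 ^ j (u − 1) < s u determine (s , u).
hyperbola : ℕ → ℕ → List (ℕ × ℕ)
hyperbola k N = cartesianProductWith (λ j w →
  let instance _ = m^n≢0 2 j in 2 ^ j + w % 2 ^ j , suc (w / 2 ^ j)) (upTo k) (upTo N)

length-hyperbola : ∀ k N → length (hyperbola k N) ≡ k * N
length-hyperbola k N = trans (length-cartesianProductWith _ (upTo k) (upTo N))
                             (cong₂ _*_ (length-upTo k) (length-upTo N))

binary-length : ∀ k {s} → 0 < s → s < 2 ^ k → ∃[ j ] j < k × ∃[ r ] r < 2 ^ j × s ≡ 2 ^ j + r
binary-length zero    0<s s<1 = contradiction 0<s (<⇒≱ s<1)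
binary-length (suc k) {s} 0<s s<2^1+k with s <? 2 ^ k
... | yes s<2^k = map₂ (map₁ m<n⇒m<1+n) (binary-length k 0<s s<2^k)
... | no  s≮2^k = k , n<1+n k , s ∸ 2 ^ k
    , +-cancelˡ-< (2 ^ k) _ _ (subst₂ _<_ s≡ (cong (2 ^ k +_) (+-identityʳ _)) s<2^1+k) , s≡
  where s≡ = sym (m+[n∸m]≡n (≮⇒≥ s≮2^k))

∈-hyperbola : ∀ k {N s u} → 0 < s → 0 < u → s < 2 ^ k → s * u ≤ N → (s , u) ∈ hyperbola k N
∈-hyperbola k {N} {s} {suc u} 0<s _ s<2^k su≤N
  with j , j<k , r , r<2^j , refl ← binary-length k 0<s s<2^k =
  subst (_∈ hyperbola k N) (cong₂ _,_ (cong (2 ^ j +_) w%) (cong suc w/))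
    (∈-cartesianProductWith⁺ _ (∈-upTo⁺ j<k) (∈-upTo⁺ w<N))
  where
  instance _ = m^n≢0 2 j
  -- The pattern `suc u` makes this `u` one less than the original, hence the quotient of `w` by
  -- `2 ^ j`.
  w = r + u * 2 ^ j

  w% : w % 2 ^ j ≡ r
  w% = trans ([m+kn]%n≡m%n r u (2 ^ j)) (m<n⇒m%n≡m r<2^j)

  w/ : w / 2 ^ j ≡ u
  w/ = trans (+-distrib-/-∣ʳ r (divides-refl u)) (cong₂ _+_ (m<n⇒m/n≡0 r<2^j) (m*n/n≡m u (2 ^ j)))

  open ≤-Reasoning
  w<N : w < N
  w<N = begin-strict
    r + u * 2 ^ j       <⟨ +-monoˡ-< (u * 2 ^ j) r<2^j ⟩
    suc u * 2 ^ j       ≤⟨ *-monoʳ-≤ (suc u) (m≤m+n (2 ^ j) r) ⟩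
    suc u * (2 ^ j + r) ≡⟨ *-comm (suc u) (2 ^ j + r) ⟩
    (2 ^ j + r) * suc u ≤⟨ su≤N ⟩
    N                   ∎

-- Take s = gcd a c, so that a = s t and c = s u with t and u coprime. Cancelling s leaves t b = u
-- d, hence t divides d, and v is the quotient.
four-number : ∀ {a b c d} → 0 < a → a * b ≡ c * d →
  ∃[ s ] ∃[ t ] ∃[ u ] ∃[ v ] a ≡ s * t × b ≡ u * v × c ≡ s * u × d ≡ t * v
four-number {a} {b} {c} {d} 0<a ab≡cd = s , t , u , v , a≡st , b≡uv , c≡su , d≡tv
  where
  s = gcd a c
  instance
    s≢0 : NonZero s
    s≢0 = ≢-nonZero (gcd[m,n]≢0 a c (inj₁ (>⇒≢ 0<a)))
    a≢0 : NonZero a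
    a≢0 = >-nonZero 0<a
  t = a / s
  u = c / s
  a≡st : a ≡ s * t
  a≡st = sym (m*[n/m]≡n (gcd[m,n]∣m a c))
  c≡su : c ≡ s * u
  c≡su = sym (m*[n/m]≡n (gcd[m,n]∣n a c))

  tb≡ud : t * b ≡ u * d
  tb≡ud = *-cancelˡ-≡ _ _ s $ begin
    s * (t * b) ≡⟨ *-assoc s t b ⟨
    s * t * b   ≡⟨ cong (_* b) a≡st ⟨
    a * b       ≡⟨ ab≡cd ⟩
    c * d       ≡⟨ cong (_* d) c≡su ⟩
    s * u * d   ≡⟨ *-assoc s u d ⟩
    s * (u * d) ∎
    where open ≡-Reasoning

  t∣d = coprime-divisor (coprime-/gcd a c) (divides b (trans (sym tb≡ud) (*-comm t b)))
  v = _∣_.quotient t∣d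

  d≡tv : d ≡ t * v
  d≡tv = trans (_∣_.equality t∣d) (*-comm v t)

  t≢0 : NonZero t
  t≢0 = m*n≢0⇒n≢0 s {{subst NonZero a≡st a≢0}}

  b≡uv : b ≡ u * v
  b≡uv = *-cancelˡ-≡ _ _ t {{t≢0}} $ begin
    t * b       ≡⟨ tb≡ud ⟩
    u * d       ≡⟨ cong (u *_) d≡tv ⟩
    u * (t * v) ≡⟨ swap₃ u t v ⟩
    t * (u * v) ∎
    where
    open ≡-Reasoning
    swap₃ : ∀ u t v → u * (t * v) ≡ t * (u * v)
    swap₃ = solve-∀

norm : ℕ × ℕ → ℕ
norm (x , y) = x ^ 2 + y ^ 2

-- From a = s t, b = u v, c = s u, d = t v a bad point is recovered as x = (a + b) / 2, y = (d - c)
-- / 2. The factors are paired as (s , u) and (t , v) because it is c and d that `N` bounds.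
candidates : ℕ → ℕ → List (ℕ × ℕ)
candidates k N = cartesianProductWith
  (λ (s , u) (t , v) → ⌊ s * t + u * v /2⌋ , ⌊ t * v ∸ s * u /2⌋)
  (hyperbola k N) (hyperbola k N)

length-candidates : ∀ k N → length (candidates k N) ≡ (k * N) ^ 2
length-candidates k N = trans (length-cartesianProductWith _ (hyperbola k N) (hyperbola k N))
  (trans (cong₂ _*_ (length-hyperbola k N) (length-hyperbola k N)) (cong (k * N *_) (sym (*-identityʳ _))))

⌊[2*n]/2⌋≡n : ∀ n → ⌊ 2 * n /2⌋ ≡ n
⌊[2*n]/2⌋≡n n = trans (cong (λ m → ⌊ n + m /2⌋) (+-identityʳ n)) (sym (n≡⌊n+n/2⌋ n))

-- Equal norms mean (x + a)² - x² = (y + c)² - y², and both sides factor. The increments `a` and `c`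
-- avoid subtraction in ℕ.
norm-difference : ∀ x a y c → norm (x , y + c) ≡ norm (x + a , y) → a * (2 * x + a) ≡ c * (2 * y + c)
norm-difference x a y c eq = +-cancelˡ-≡ (x ^ 2 + y ^ 2) _ _
  (trans (expandˡ x a y) (trans (sym eq) (expandʳ x y c)))
  where
  expandˡ : ∀ x a y → x * (x * 1) + y * (y * 1) + a * (2 * x + a) ≡ (x + a) * ((x + a) * 1) + y * (y * 1)
  expandˡ = solve-∀
  expandʳ : ∀ x y c → x * (x * 1) + (y + c) * ((y + c) * 1) ≡ x * (x * 1) + y * (y * 1) + c * (2 * y + c)
  expandʳ = solve-∀

norm-reflects-≥ : ∀ {x x' y y'} → norm (x' , y') ≡ norm (x , y) → x' ≤ x → y ≤ y'
norm-reflects-≥ eq x'≤x = ≮⇒≥ λ y'<y → <⇒≢ (+-mono-≤-< (^-monoˡ-≤ 2 x'≤x) (^-monoˡ-< 2 y'<y)) eq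

∈-candidates : ∀ k {N x y} s t u v .{{_ : NonZero (s * t)}} .{{_ : NonZero (u * v)}} → N < 2 ^ k →
  s * u ≤ N → t * v ≤ N → s * t + u * v ≡ 2 * x → t * v ≡ 2 * y + s * u → (x , y) ∈ candidates k N
∈-candidates k {N} {x} {y} s t u v N<2^k su≤N tv≤N x≡ y≡ =
  subst (_∈ candidates k N) (cong₂ _,_ halfˣ halfʸ) (∈-cartesianProductWith⁺ _
    (∈-hyperbola k (>-nonZero⁻¹ s) (>-nonZero⁻¹ u) (≤-<-trans (m≤m*n s u) (≤-<-trans su≤N N<2^k)) su≤N)
    (∈-hyperbola k (>-nonZero⁻¹ t) (>-nonZero⁻¹ v) (≤-<-trans (m≤m*n t v) (≤-<-trans tv≤N N<2^k)) tv≤N))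
  where
  instance
    s≢0 : NonZero s
    s≢0 = m*n≢0⇒m≢0 s {t}
    t≢0 : NonZero t
    t≢0 = m*n≢0⇒n≢0 s {t}
    u≢0 : NonZero u
    u≢0 = m*n≢0⇒m≢0 u {v}
    v≢0 : NonZero v
    v≢0 = m*n≢0⇒n≢0 u {v}

  halfˣ : ⌊ s * t + u * v /2⌋ ≡ x
  halfˣ = trans (cong ⌊_/2⌋ x≡) (⌊[2*n]/2⌋≡n x)

  halfʸ : ⌊ t * v ∸ s * u /2⌋ ≡ y
  halfʸ = trans (cong ⌊_/2⌋ (trans (cong (_∸ s * u) y≡) (m+n∸n≡m (2 * y) (s * u)))) (⌊[2*n]/2⌋≡n y)

-- The partner (x , y + c) has height at most B, so c ≤ B and d = (y + c) + y ≤ 2 B, which puts both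
-- pairs of factors under the hyperbola.
collision∈candidates : ∀ k {B} x a y c → 2 * B < 2 ^ k → 0 < a → y + c ≤ B →
  norm (x , y + c) ≡ norm (x + a , y) → (x + a , y) ∈ candidates k (2 * B)
collision∈candidates k {B} x a y c 2B<2^k 0<a y+c≤B eq =
  let s , t , u , v , a≡st , b≡uv , c≡su , d≡tv = four-number 0<a (norm-difference x a y c eq) in
    ∈-candidates k s t u v
      {{>-nonZero (subst (0 <_) a≡st 0<a)}}
      {{>-nonZero (subst (0 <_) b≡uv (≤-trans 0<a (m≤n+m a (2 * x))))}}
      2B<2^k
      (subst (_≤ 2 * B) c≡su (≤-trans (m≤n+m c y) (≤-trans y+c≤B (m≤m+n B _))))
      (subst (_≤ 2 * B) d≡tv d≤2B)
      (trans (cong₂ _+_ (sym a≡st) (sym b≡uv)) (regroupˣ x a))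
      (trans (sym d≡tv) (cong (2 * y +_) c≡su))
  where
  open ≤-Reasoning
  regroupˣ : ∀ x a → a + (2 * x + a) ≡ 2 * (x + a)
  regroupˣ = solve-∀
  regroupʸ : ∀ y c → 2 * y + c ≡ y + c + y
  regroupʸ = solve-∀

  d≤2B : 2 * y + c ≤ 2 * B
  d≤2B = begin
    2 * y + c         ≡⟨ regroupʸ y c ⟩
    y + c + y         ≤⟨ +-mono-≤ y+c≤B (≤-trans (m≤m+n y c) y+c≤B) ⟩
    B + B             ≡⟨ cong (B +_) (+-identityʳ B) ⟨
    2 * B             ∎

box : ℕ → ℕ → List (ℕ × ℕ)
box A B = cartesianProductWith (λ i j → suc i , suc j) (upTo A) (upTo B)

box! : ∀ A B → Unique (box A B)
box! A B = Unique.cartesianProductWith⁺ _ (λ where refl → refl , refl) (Unique.upTo⁺ A) (Unique.upTo⁺ B)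

length-box : ∀ A B → length (box A B) ≡ A * B
length-box A B = trans (length-cartesianProductWith _ (upTo A) (upTo B)) (cong₂ _*_ (length-upTo A) (length-upTo B))

∈-box⁻ : ∀ A B {x y} → (x , y) ∈ box A B → (0 < x × x ≤ A) × (0 < y × y ≤ B)
∈-box⁻ A B p with _ , _ , i∈ , j∈ , refl ← ∈-cartesianProductWith⁻ _ (upTo A) (upTo B) p =
  (z<s , ∈-upTo⁻ i∈) , (z<s , ∈-upTo⁻ j∈)

-- For `ps` the box, these are the bad points of the overview; the strict inequality spares the
-- leftmost point of each norm.
Collides : List (ℕ × ℕ) → ℕ × ℕ → Set
Collides ps p = Any (λ p' → proj₁ p' < proj₁ p × norm p' ≡ norm p) ps

collides? : ∀ ps → Decidable (Collides ps)
collides? ps p = any? (λ p' → (proj₁ p' <? proj₁ p) ×-dec (norm p' ≟ norm p)) ps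

-- Different abscissas would make the point further right bad; with equal abscissas the norm
-- determines the ordinate.
norm-injective-∉Collides : ∀ {ps p q} → p ∈ ps → ¬ Collides ps p → q ∈ ps → ¬ Collides ps q →
  norm p ≡ norm q → p ≡ q
norm-injective-∉Collides {ps} {x , y} {x' , y'} p∈ ¬p q∈ ¬q eq with <-cmp x x'
... | tri< x<x' _ _ = contradiction (lose p∈ (x<x' , eq)) ¬q
... | tri> _ _ x>x' = contradiction (lose q∈ (x>x' , sym eq)) ¬p
... | tri≈ _ refl _ = cong (x ,_) (≤-antisym
  (norm-reflects-≥ {x} {x} {y} {y'} (sym eq) ≤-refl) (norm-reflects-≥ {x} {x} {y'} {y} eq ≤-refl))

-- A partner further left with the same norm lies at least as high, so the truncated differences
-- `x ∸ x'` and `y' ∸ y` are true differences.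
Collides⇒∈candidates : ∀ k A B {p} → 2 * B < 2 ^ k → p ∈ box A B → Collides (box A B) p →
  p ∈ candidates k (2 * B)
Collides⇒∈candidates k A B {x , y} 2B<2^k p∈ bad
  with (x' , y') , q∈ , x'<x , eq ← find bad = subst (_∈ candidates k (2 * B)) (cong (_, y) x'+a≡x)
    (collision∈candidates k x' (x ∸ x') y (y' ∸ y) 2B<2^k (m<n⇒0<n∸m x'<x)
      (subst (_≤ B) (sym y+c≡y') (proj₂ (proj₂ (∈-box⁻ A B q∈))))
      (trans (cong (λ y → norm (x' , y)) y+c≡y') (trans eq (cong (λ x → norm (x , y)) (sym x'+a≡x)))))
  where
  x'+a≡x : x' + (x ∸ x') ≡ x
  x'+a≡x = m+[n∸m]≡n (<⇒≤ x'<x)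
  y+c≡y' : y + (y' ∸ y) ≡ y'
  y+c≡y' = m+[n∸m]≡n (norm-reflects-≥ {x} {x'} {y} {y'} eq (<⇒≤ x'<x))

-- The box is covered by its good points, on which `norm` is injective, and by the list of
-- candidates, of length (2 k B)². Repetitions among the candidates only weaken the bound.
box-count : ∀ k A B {ms} → (∀ {p} → p ∈ box A B → norm p ∈ ms) → 2 * B < 2 ^ k →
  A * B ≤ length ms + (k * (2 * B)) ^ 2
box-count k A B {ms} norm∈ 2B<2^k = begin
  A * B                                        ≡⟨ length-box A B ⟨
  length (box A B)
    ≤⟨ length-mono-injective (setoid _) (setoid _) id (box! A B) split (λ _ _ eq → eq) ⟩
  length (good ++ candidates k (2 * B))        ≡⟨ length-++ good ⟩
  length good + length (candidates k (2 * B))  ≤⟨ +-mono-≤ good≤ (≤-reflexive (length-candidates k (2 * B))) ⟩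
  length ms + (k * (2 * B)) ^ 2                ∎
  where
  open ≤-Reasoning
  good? : Decidable (¬_ ∘ Collides (box A B))
  good? = ¬? ∘ collides? (box A B)
  good = filter good? (box A B)

  good≤ : length good ≤ length ms
  good≤ = length-mono-injective (setoid _) (setoid _) norm (Unique.filter⁺ good? (box! A B))
    (norm∈ ∘ proj₁ ∘ ∈-filter⁻ good? {xs = box A B})
    (λ p∈ q∈ → let p∈box , p-good = ∈-filter⁻ good? {xs = box A B} p∈
                   q∈box , q-good = ∈-filter⁻ good? {xs = box A B} q∈
               in norm-injective-∉Collides p∈box p-good q∈box q-good)

  split : ∀ {p} → p ∈ box A B → p ∈ good ++ candidates k (2 * B)
  split {p} p∈ with collides? (box A B) p
  ... | yes bad = ∈-++⁺ʳ good (Collides⇒∈candidates k A B 2B<2^k p∈ bad)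
  ... | no ¬bad = ∈-++⁺ˡ (∈-filter⁺ good? p∈ ¬bad)

-- Norms of the possible difference vectors

allNorms norms : ℕ → ℕ → List ℕ
allNorms A B = cartesianProductWith (λ x y → norm (x , y)) (upTo (suc A)) (upTo (suc B))
norms    A B = filter nonZero? (deduplicate _≟_ (allNorms A B))

norms! : ∀ A B → Unique (norms A B)
norms! A B = Unique.filter⁺ nonZero? (UniqueDec.deduplicate-! _≟_ (allNorms A B))

∈-norms⁺ : ∀ A B {x y} → x ≤ A → y ≤ B → NonZero (norm (x , y)) → norm (x , y) ∈ norms A B
∈-norms⁺ A B x≤A y≤B = ∈-filter⁺ nonZero? (∈-deduplicate⁺ _≟_ {allNorms A B}
  (∈-cartesianProductWith⁺ (λ x y → norm (x , y)) (∈-upTo⁺ (s≤s x≤A)) (∈-upTo⁺ (s≤s y≤B))))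

∈-norms⁻ : ∀ A B {m} → m ∈ norms A B → NonZero m × ∃[ x ] ∃[ y ] x ≤ A × y ≤ B × m ≡ norm (x , y)
∈-norms⁻ A B m∈ =
  let m∈' , m≢0 = ∈-filter⁻ nonZero? {xs = deduplicate _≟_ (allNorms A B)} m∈
      x , y , x∈ , y∈ , m≡ = ∈-cartesianProductWith⁻ (λ x y → norm (x , y)) (upTo (suc A)) (upTo (suc B))
                               (∈-deduplicate⁻ _≟_ (allNorms A B) m∈')
  in m≢0 , x , y , s≤s⁻¹ (∈-upTo⁻ x∈) , s≤s⁻¹ (∈-upTo⁻ y∈) , m≡

length-norms-≤ : ∀ A B → length (norms A B) ≤ suc A * suc B
length-norms-≤ A B = begin
  length (norms A B)
    ≤⟨ length-filter nonZero? (deduplicate _≟_ (allNorms A B)) ⟩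
  length (deduplicate _≟_ (allNorms A B))
    ≤⟨ length-mono-injective (setoid _) (setoid _) id (UniqueDec.deduplicate-! _≟_ (allNorms A B))
         (∈-deduplicate⁻ _≟_ (allNorms A B)) (λ _ _ eq → eq) ⟩
  length (allNorms A B)
    ≡⟨ length-cartesianProductWith _ (upTo (suc A)) (upTo (suc B)) ⟩
  length (upTo (suc A)) * length (upTo (suc B))
    ≡⟨ cong₂ _*_ (length-upTo (suc A)) (length-upTo (suc B)) ⟩
  suc A * suc B ∎
  where open ≤-Reasoning

-- The hypothesis on A says that the bad points, at most 4 k² B² of them, fill at most half of the
-- box, and the remaining points have distinct norms.
length-norms-≥ : ∀ k {A B} → 2 * B < 2 ^ k → 8 * k ^ 2 * B ≤ A → A * B ≤ 2 * length (norms A B)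
length-norms-≥ k {A} {B} 2B<2^k small = +-cancelˡ-≤ (A * B) _ _ $ begin
  A * B + A * B                                       ≡⟨ double (A * B) ⟩
  2 * (A * B)                                         ≤⟨ *-monoʳ-≤ 2 (box-count k A B norm∈ 2B<2^k) ⟩
  2 * (length (norms A B) + (k * (2 * B)) ^ 2)        ≡⟨ expand (length (norms A B)) k B ⟩
  8 * k ^ 2 * B * B + 2 * length (norms A B)          ≤⟨ +-monoˡ-≤ _ (*-monoˡ-≤ B small) ⟩
  A * B + 2 * length (norms A B)                      ∎
  where
  open ≤-Reasoning
  double : ∀ a → a + a ≡ 2 * a
  double = solve-∀
  expand : ∀ L k B → 2 * (L + k * (2 * B) * (k * (2 * B) * 1)) ≡ 8 * (k * (k * 1)) * B * B + 2 * L
  expand = solve-∀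
  norm∈ : ∀ {p} → p ∈ box A B → norm p ∈ norms A B
  norm∈ p∈ = let (0<x , x≤A) , (0<y , y≤B) = ∈-box⁻ A B p∈ in
    ∈-norms⁺ A B x≤A y≤B (>-nonZero (≤-trans (^-monoˡ-≤ 2 0<x) (m≤m+n _ _)))

-- Powers of logarithms against n

n<2^n : ∀ n → n < 2 ^ n
n<2^n zero    = z<s
n<2^n (suc n) = begin-strict
  suc n         <⟨ s≤s (n<2^n n) ⟩
  1 + 2 ^ n     ≤⟨ +-monoˡ-≤ (2 ^ n) (m^n>0 2 n) ⟩
  2 ^ n + 2 ^ n ≡⟨ cong (2 ^ n +_) (+-identityʳ (2 ^ n)) ⟨
  2 ^ suc n     ∎
  where open ≤-Reasoning

-- With p = j / (4 m) + 1 ≥ 32 m, both 8 (2 + j)² ≤ p ^ 4 and p ^ (4 m) ≤ 2 ^ j.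
polynomial≤exponential : ∀ m {j} .{{_ : NonZero m}} → 128 * (m * m) ≤ j → (8 * (2 + j) ^ 2) ^ m ≤ 2 ^ j
polynomial≤exponential m {j} j≥ = begin
  (8 * (2 + j) ^ 2) ^ m       ≤⟨ ^-monoˡ-≤ m (*-monoʳ-≤ 8 (^-monoˡ-≤ 2 2+j≤8mp)) ⟩
  (8 * (8 * m * p) ^ 2) ^ m   ≡⟨ cong (_^ m) (regroup₁ m p) ⟩
  (512 * (m * m) * (p * p)) ^ m ≤⟨ ^-monoˡ-≤ m (*-monoˡ-≤ (p * p) (*-monoˡ-≤ (m * m) 512≤1024)) ⟩
  (1024 * (m * m) * (p * p)) ^ m ≡⟨ cong (_^ m) (regroup₂ m p) ⟩
  (32 * m * (32 * m) * (p * p)) ^ m ≤⟨ ^-monoˡ-≤ m (*-monoˡ-≤ (p * p) (*-mono-≤ 32m≤p 32m≤p)) ⟩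
  (p * p * (p * p)) ^ m       ≡⟨ cong (_^ m) (regroup₃ p) ⟩
  (p ^ 4) ^ m                 ≤⟨ ^-monoˡ-≤ m (^-monoˡ-≤ 4 (n<2^n t)) ⟩
  ((2 ^ t) ^ 4) ^ m           ≡⟨ ^-*-assoc (2 ^ t) 4 m ⟩
  (2 ^ t) ^ (4 * m)           ≡⟨ ^-*-assoc 2 t (4 * m) ⟩
  2 ^ (t * (4 * m))           ≤⟨ ^-monoʳ-≤ 2 (m/n*n≤m j (4 * m)) ⟩
  2 ^ j                       ∎
  where
  open ≤-Reasoning
  instance
    4m≢0 : NonZero (4 * m)
    4m≢0 = m*n≢0 4 m
  t = j / (4 * m)
  p = suc t

  512≤1024 : 512 ≤ 1024
  512≤1024 = ≤ᵇ⇒≤ 512 1024 _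

  32m≤p : 32 * m ≤ p
  32m≤p = ≤-trans (≤-trans (≤-reflexive (trans (sym (m*n/n≡m (32 * m) (4 * m))) (cong (_/ (4 * m)) (regroup₄ m))))
            (/-monoˡ-≤ (4 * m) j≥)) (n≤1+n t)
    where
    regroup₄ : ∀ m → 32 * m * (4 * m) ≡ 128 * (m * m)
    regroup₄ = solve-∀

  2+j≤8mp : 2 + j ≤ 8 * m * p
  2+j≤8mp = begin
    2 + j                     ≡⟨ cong (2 +_) (m≡m%n+[m/n]*n j (4 * m)) ⟩
    2 + (j % (4 * m) + t * (4 * m)) ≤⟨ +-monoʳ-≤ 1 (+-monoˡ-≤ (t * (4 * m)) (m%n<n j (4 * m))) ⟩
    1 + (4 * m + t * (4 * m)) ≤⟨ +-monoˡ-≤ _ (>-nonZero⁻¹ (p * (4 * m)) {{m*n≢0 p (4 * m)}}) ⟩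
    p * (4 * m) + p * (4 * m) ≡⟨ regroup p m ⟩
    8 * m * p                 ∎
    where
    regroup : ∀ p m → p * (4 * m) + p * (4 * m) ≡ 8 * m * p
    regroup = solve-∀

  regroup₁ : ∀ m p → 8 * (8 * m * p * (8 * m * p * 1)) ≡ 512 * (m * m) * (p * p)
  regroup₁ = solve-∀
  regroup₂ : ∀ m p → 1024 * (m * m) * (p * p) ≡ 32 * m * (32 * m) * (p * p)
  regroup₂ = solve-∀
  regroup₃ : ∀ p → p * p * (p * p) ≡ p * (p * (p * (p * 1)))
  regroup₃ = solve-∀

-- With 2 ^ j ≤ n < 2 ^ (j + 1), take k = j + 2. The threshold on n forces j ≥ 128 m², where
-- `polynomial≤exponential` applies. The power m expresses 8 k² ≤ n ^ (1 / m) in integers.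
log-scale : ∀ m {n} .{{_ : NonZero m}} → 2 ^ (128 * (m * m)) ≤ n → ∃[ k ] 2 * n < 2 ^ k × (8 * k ^ 2) ^ m ≤ n
log-scale m {n} n≥ with j , _ , r , r<2^j , n≡ ← binary-length n (≤-trans (m^n>0 2 (128 * (m * m))) n≥) (n<2^n n) =
  2 + j , *-monoʳ-< 2 n<2^1+j ,
  ≤-trans (polynomial≤exponential m {j} (≮⇒≥ λ j<128mm → <⇒≱ n<2^1+j (≤-trans (^-monoʳ-≤ 2 j<128mm) n≥)))
          (subst (2 ^ j ≤_) (sym n≡) (m≤m+n _ r))
  where
  open ≤-Reasoning
  n<2^1+j : n < 2 ^ suc j
  n<2^1+j = begin-strict
    n             ≡⟨ n≡ ⟩
    2 ^ j + r     <⟨ +-monoʳ-< (2 ^ j) r<2^j ⟩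
    2 ^ j + 2 ^ j ≡⟨ cong (2 ^ j +_) (+-identityʳ _) ⟨
    2 ^ suc j     ∎

-- Fractions, cuts and real exponents

toℚᵘ-/ : ∀ p q → ℚ.toℚᵘ (pos p ℚ./ suc q) ℚᵘ.≃ mkℚᵘ (pos p) q
toℚᵘ-/ p q = ℚ.toℚᵘ-fromℚᵘ (mkℚᵘ (pos p) q)

fraction-mono-< : ∀ p q p' q' .{{_ : NonZero q}} .{{_ : NonZero q'}} →
  p * q' < p' * q → pos p ℚ./ q ℚ.< pos p' ℚ./ q'
fraction-mono-< p (suc q) p' (suc q') lt = ℚ.toℚᵘ-cancel-< (ℚᵘ.<-respˡ-≃ (ℚᵘ.≃-sym (toℚᵘ-/ p q))
  (ℚᵘ.<-respʳ-≃ (ℚᵘ.≃-sym (toℚᵘ-/ p' q'))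
    (ℚᵘ.*<* (subst₂ ℤ._<_ (ℤ.pos-* p (suc q')) (ℤ.pos-* p' (suc q)) (ℤ.+<+ lt)))))

fraction-cancel-< : ∀ p q p' q' .{{_ : NonZero q}} .{{_ : NonZero q'}} →
  pos p ℚ./ q ℚ.< pos p' ℚ./ q' → p * q' < p' * q
fraction-cancel-< p (suc q) p' (suc q') lt = ℤ.drop‿+<+ (subst₂ ℤ._<_
  (sym (ℤ.pos-* p (suc q'))) (sym (ℤ.pos-* p' (suc q)))
  (ℚᵘ.drop-*<* (ℚᵘ.<-respˡ-≃ (toℚᵘ-/ p q) (ℚᵘ.<-respʳ-≃ (toℚᵘ-/ p' q') (ℚ.toℚᵘ-mono-< lt)))))

fraction-mono-≤ : ∀ p q p' q' .{{_ : NonZero q}} .{{_ : NonZero q'}} →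
  p * q' ≤ p' * q → pos p ℚ./ q ℚ.≤ pos p' ℚ./ q'
fraction-mono-≤ p q p' q' le = ℚ.≮⇒≥ λ lt → <⇒≱ (fraction-cancel-< p' q' p q lt) le

fraction-cancel-≤ : ∀ p q p' q' .{{_ : NonZero q}} .{{_ : NonZero q'}} →
  pos p ℚ./ q ℚ.≤ pos p' ℚ./ q' → p * q' ≤ p' * q
fraction-cancel-≤ p q p' q' le = ≮⇒≥ λ lt → ℚ.<-irrefl refl (ℚ.≤-<-trans le (fraction-mono-< p' q' p q lt))

fraction-cong-* : ∀ p q p' q' .{{_ : NonZero q}} .{{_ : NonZero q'}} →
  p * q' ≡ p' * q → pos p ℚ./ q ≡ pos p' ℚ./ q'
fraction-cong-* p q p' q' eq = ℚ.≤-antisym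
  (fraction-mono-≤ p q p' q' (≤-reflexive eq)) (fraction-mono-≤ p' q' p q (≤-reflexive (sym eq)))

fraction-+-homo : ∀ p q p' q' .{{_ : NonZero q}} .{{_ : NonZero q'}} →
  pos p ℚ./ q ℚ.+ pos p' ℚ./ q' ≡ (pos (p * q' + p' * q) ℚ./ (q * q')) {{m*n≢0 q q'}}
fraction-+-homo p (suc q) p' (suc q') = ℚ.toℚᵘ-injective (ℚᵘ.≃-trans
  (ℚ.toℚᵘ-homo-+ (pos p ℚ./ suc q) (pos p' ℚ./ suc q'))
  (ℚᵘ.≃-trans (ℚᵘ.+-cong (toℚᵘ-/ p q) (toℚᵘ-/ p' q'))
  (ℚᵘ.≃-trans (ℚᵘ.≃-reflexive (cong (λ i → mkℚᵘ i _) numerators)) (ℚᵘ.≃-sym (toℚᵘ-/ _ _)))))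
  where
  numerators : pos p ℤ.* pos (suc q') ℤ.+ pos p' ℤ.* pos (suc q) ≡ pos (p * suc q' + p' * suc q)
  numerators = trans (sym (cong₂ ℤ._+_ (ℤ.pos-* p (suc q')) (ℤ.pos-* p' (suc q)))) (sym (ℤ.pos-+ _ (p' * suc q)))

fraction-*-homo : ∀ p q p' q' .{{_ : NonZero q}} .{{_ : NonZero q'}} →
  pos p ℚ./ q ℚ.* (pos p' ℚ./ q') ≡ (pos (p * p') ℚ./ (q * q')) {{m*n≢0 q q'}}
fraction-*-homo p (suc q) p' (suc q') = ℚ.toℚᵘ-injective (ℚᵘ.≃-trans
  (ℚ.toℚᵘ-homo-* (pos p ℚ./ suc q) (pos p' ℚ./ suc q'))
  (ℚᵘ.≃-trans (ℚᵘ.*-cong (toℚᵘ-/ p q) (toℚᵘ-/ p' q'))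
  (ℚᵘ.≃-trans (ℚᵘ.≃-reflexive (cong (λ i → mkℚᵘ i _) (sym (ℤ.pos-* p p'))))
    (ℚᵘ.≃-sym (toℚᵘ-/ _ _)))))

positive-fraction : ∀ q → 0ℚ ℚ.< q → ∃[ b ] ∃[ m ] Σ[ m≢0 ∈ NonZero m ] q ≡ (pos b ℚ./ m) {{m≢0}}
positive-fraction q@(mkℚ (pos b)    m _) _ = b , suc m , _ , sym (ℚ.↥p/↧p≡p q)
positive-fraction (mkℚ -[1+ b ] m _) (*<* ())

private
  a-[a-q]≡q : ∀ a q → a ℚ.- (a ℚ.- q) ≡ q
  a-[a-q]≡q = +-*-Solver.solve 2 (λ a q → a :- (a :- q) := q) refl
    where open +-*-Solver

  a+[b-a]≡b : ∀ a b → a ℚ.+ (b ℚ.- a) ≡ b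
  a+[b-a]≡b = +-*-Solver.solve 2 (λ a b → a :+ (b :- a) := b) refl
    where open +-*-Solver

L<U : ∀ x {q r} → L x q → U x r → q ℚ.< r
L<U x {q} {r} Lq Ur with ℚ.<-cmp q r
... | tri< q<r _ _ = q<r
... | tri≈ _ refl _ = contradiction (Lq , Ur) (disjoint x)
... | tri> _ _ r<q = contradiction (L-down x r<q Lq , Ur) (disjoint x)

U⇒<ᴿ : ∀ x {q} → U x q → x <ᴿ fromℚ q
U⇒<ᴿ x Uq = let r , r<q , Ur = U-open x Uq in r , Ur , r<q

-- The two cuts give 1 - r < α < s with r < p / q and s < p' / q', so p / q + p' / q' > 1; the
-- conclusion clears denominators.
exponent-sum : ∀ α p q p' q' .{{_ : NonZero q}} .{{_ : NonZero q'}} →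
  1ℚ -ᴿ α <ᴿ fromℚ (pos p ℚ./ q) → α <ᴿ fromℚ (pos p' ℚ./ q') → q * q' < p * q' + p' * q
exponent-sum α p q p' q' (r , L1-r , r<p/q) (s , Us , s<p'/q') =
  subst₂ _<_ (*-identityˡ (q * q')) (*-identityʳ _)
    (fraction-cancel-< 1 1 (p * q' + p' * q) (q * q') {{_}} {{m*n≢0 q q'}}
    (subst₂ ℚ._<_ (a+[b-a]≡b r 1ℚ) (fraction-+-homo p q p' q')
      (ℚ.+-mono-< r<p/q (ℚ.<-trans (L<U α L1-r Us) s<p'/q'))))

-- Openness of the lower cut gives p / q < s < α, and 1 - s separates 1 - α from r / q = 1 - p / q.
1-ᴿ-< : ∀ α p q r .{{_ : NonZero q}} → p + r ≡ q → L α (pos p ℚ./ q) →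
  1ℚ -ᴿ α <ᴿ fromℚ (pos r ℚ./ q)
1-ᴿ-< α p q r p+r≡q Lp/q =
  let s , p/q<s , Ls = L-open α Lp/q in
  1ℚ ℚ.- s , subst (L α) (sym (a-[a-q]≡q 1ℚ s)) Ls ,
  subst (1ℚ ℚ.- s ℚ.<_) 1-p/q≡r/q (ℚ.+-monoʳ-< 1ℚ (ℚ.neg-antimono-< p/q<s))
  where
  p/q+r/q≡1 : pos p ℚ./ q ℚ.+ pos r ℚ./ q ≡ 1ℚ
  p/q+r/q≡1 = trans (fraction-+-homo p q r q) (fraction-cong-* (p * q + r * q) (q * q) 1 1 {{m*n≢0 q q}} (begin
    (p * q + r * q) * 1 ≡⟨ *-identityʳ _ ⟩
    p * q + r * q       ≡⟨ *-distribʳ-+ q p r ⟨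
    (p + r) * q         ≡⟨ cong (_* q) p+r≡q ⟩
    q * q               ≡⟨ *-identityˡ _ ⟨
    1 * (q * q)         ∎))
    where open ≡-Reasoning
  1-p/q≡r/q : 1ℚ ℚ.- pos p ℚ./ q ≡ pos r ℚ./ q
  1-p/q≡r/q = trans (cong (ℚ._- pos p ℚ./ q) (sym p/q+r/q≡1)) (cancel (pos p ℚ./ q) (pos r ℚ./ q))
    where
    open +-*-Solver
    cancel : ∀ a b → a ℚ.+ b ℚ.- a ≡ b
    cancel = solve 2 (λ a b → a :+ b :- a := b) refl

pos-^ : ∀ i q → pos (i ^ q) ≡ pos i ℤ.^ q
pos-^ i zero    = refl
pos-^ i (suc q) = trans (ℤ.pos-* i (i ^ q)) (cong (pos i ℤ.*_) (pos-^ i q))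

≤^ᴿ⁻ : ∀ {i n x} → pos i ≤ n ^ᴿ x →
  ∀ p q .{{_ : NonZero q}} → x <ᴿ fromℚ (pos p ℚ./ q) → i ^ q ≤ n ^ p
≤^ᴿ⁻ {i} {n} i≤ p q x< = ℤ.drop‿+≤+ (subst (ℤ._≤ pos (n ^ p)) (sym (pos-^ i q)) (i≤ p q x<))

≤^ᴿ⁺ : ∀ {i n x} → (∀ p q .{{_ : NonZero q}} → x <ᴿ fromℚ (pos p ℚ./ q) → i ^ q ≤ n ^ p) →
  pos i ≤ n ^ᴿ x
≤^ᴿ⁺ {i} {n} i≤ p q x< = subst (ℤ._≤ pos (n ^ p)) (pos-^ i q) (+≤+ (i≤ p q x<))

≤^ᴿ-down : ∀ {i j n x} → i ≤ j → pos j ≤ n ^ᴿ x → pos i ≤ n ^ᴿ x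
≤^ᴿ-down {i} {j} {n} {x} i≤j j≤ =
  ≤^ᴿ⁺ {i} {n} {x} λ p q x< → ≤-trans (^-monoˡ-≤ q i≤j) (≤^ᴿ⁻ {j} {n} {x} j≤ p q x<)

1≤^ᴿ : ∀ n x .{{_ : NonZero n}} → pos 1 ≤ n ^ᴿ x
1≤^ᴿ n x = ≤^ᴿ⁺ {1} {n} {x} λ p q _ → subst (_≤ n ^ p) (sym (^-zeroˡ q)) (m^n>0 n p)

≤^ᴿ⇒≤ : ∀ {i n x} → x <ᴿ fromℚ 1ℚ → pos i ≤ n ^ᴿ x → i ≤ n
≤^ᴿ⇒≤ {i} {n} {x} x<1 i≤ = subst₂ _≤_ (^-identityʳ i) (^-identityʳ n) (≤^ᴿ⁻ {i} {n} {x} i≤ 1 1 x<1)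

^-distribʳ-* : ∀ q a b → (a * b) ^ q ≡ a ^ q * b ^ q
^-distribʳ-* zero    a b = refl
^-distribʳ-* (suc q) a b = trans (cong (a * b *_) (^-distribʳ-* q a b)) (*-interchange a b (a ^ q) (b ^ q))
  where
  *-interchange : ∀ a b c d → a * b * (c * d) ≡ a * c * (b * d)
  *-interchange = solve-∀

^-cancelˡ-≤ : ∀ m {a b} .{{_ : NonZero m}} → a ^ m ≤ b ^ m → a ≤ b
^-cancelˡ-≤ m a^m≤b^m = ≮⇒≥ λ b<a → <⇒≱ (^-monoˡ-< m b<a) a^m≤b^m

^-cancelˡ-< : ∀ m {a b} → a ^ m < b ^ m → a < b
^-cancelˡ-< m a^m<b^m = ≰⇒> λ b≤a → ≤⇒≯ (^-monoˡ-≤ m b≤a) a^m<b^m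

-- Failure at `N` descends: success one step lower would complete the pair, so if there is no pair,
-- failure reaches 0. As `P` need not be decidable, the pair is obtained only under double negation.
¬¬-maximum : ∀ {ℓ} {P : Pred ℕ ℓ} N → P 0 → ¬ P N → ¬ ¬ (∃[ A ] P A × ¬ P (suc A))
¬¬-maximum zero    P0 ¬PN _ = ¬PN P0
¬¬-maximum (suc N) P0 ¬PN k = ¬¬-maximum N P0 (λ PN → k (N , PN , ¬PN)) k

-- If a b ≤ n, witnesses n ^ p < a ^ q and n ^ p' < b ^ q' multiply to n ^ (p q' + p' q) < (a b) ^
-- (q q') ≤ n ^ (q q'), against `exponent-sum`.
*-lower-bound : ∀ α {n a b} .{{_ : NonZero n}} →
  ¬ (pos a ≤ n ^ᴿ (1ℚ -ᴿ α)) → ¬ (pos b ≤ n ^ᴿ α) → n < a * b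
*-lower-bound α {n} {a} {b} ¬a ¬b = ≰⇒> λ ab≤n →
  -- A negated universal statement gives no witness directly. Each is refuted by proving its
  -- inequality by contradiction, as decidability of ≤ on ℕ permits, and the contradiction assumes
  -- the witness.
  ¬a (≤^ᴿ⁺ {a} {n} {1ℚ -ᴿ α} λ p q p/q → decidable-stable (_ ≤? _) λ a^q≰n^p →
  ¬b (≤^ᴿ⁺ {b} {n} {α} λ p' q' p'/q' → decidable-stable (_ ≤? _) λ b^q'≰n^p' →
  <⇒≱ (power-< p q p' q' (≰⇒> a^q≰n^p) (≰⇒> b^q'≰n^p'))
    (≤-trans (^-monoˡ-≤ (q * q') ab≤n) (^-monoʳ-≤ n (<⇒≤ (exponent-sum α p q p' q' p/q p'/q'))))))
  where
  open ≤-Reasoning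
  power-< : ∀ p q p' q' .{{_ : NonZero q}} .{{_ : NonZero q'}} → n ^ p < a ^ q → n ^ p' < b ^ q' →
           n ^ (p * q' + p' * q) < (a * b) ^ (q * q')
  power-< p q p' q' lt lt' = begin-strict
    n ^ (p * q' + p' * q)           ≡⟨ ^-distribˡ-+-* n (p * q') (p' * q) ⟩
    n ^ (p * q') * n ^ (p' * q)     ≡⟨ cong₂ _*_ (^-*-assoc n p q') (^-*-assoc n p' q) ⟨
    (n ^ p) ^ q' * (n ^ p') ^ q     <⟨ *-mono-< (^-monoˡ-< q' lt) (^-monoˡ-< q lt') ⟩
    (a ^ q) ^ q' * (b ^ q') ^ q
      ≡⟨ cong₂ _*_ (^-*-assoc a q q') (trans (^-*-assoc b q' q) (cong (b ^_) (*-comm q' q))) ⟩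
    a ^ (q * q') * b ^ (q * q')     ≡⟨ ^-distribʳ-* (q * q') a b ⟨
    (a * b) ^ (q * q')              ∎

-- Take the last p with p / q < α. Since (p + 1) / q may equal α, it need not be in the upper cut;
-- locatedness between it and (p + 2) / q puts the latter there.
¬¬-approximation : ∀ α q .{{_ : NonZero q}} → L α 0ℚ → U α 1ℚ →
  ¬ ¬ (∃[ p ] L α (pos p ℚ./ q) × U α (pos (2 + p) ℚ./ q))
¬¬-approximation α q L0 U1 k = ¬¬-maximum {P = λ p → L α (pos p ℚ./ q)} q
  (subst (L α) (sym (ℚ.0/n≡0 q)) L0)
  (λ L1 → disjoint α (subst (L α) (fraction-cong-* q q 1 1 (*-comm q 1)) L1 , U1))
  λ (p , Lp , ¬Lp+1) → case-located p Lp ¬Lp+1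
  where
  case-located : ∀ p → L α (pos p ℚ./ q) → ¬ L α (pos (suc p) ℚ./ q) → ⊥
  case-located p Lp ¬Lp+1 with located α (fraction-mono-< (suc p) q (2 + p) q (*-monoˡ-< q (n<1+n (suc p))))
  ... | inj₁ Lp+1 = ¬Lp+1 Lp+1
  ... | inj₂ Up+2 = k (p , Lp , Up+2)

-- If 2 n ≤ a b, approximating α within 2 / q gives (2 n) ^ q ≤ n ^ (q - p) n ^ (p + 2) = n ^ (q +
-- 2), so 2 ^ q ≤ n².
*-upper-bound : ∀ α {n a b} .{{_ : NonZero n}} → L α 0ℚ → U α 1ℚ →
  pos a ≤ n ^ᴿ (1ℚ -ᴿ α) → pos b ≤ n ^ᴿ α → a * b ≤ 2 * n
*-upper-bound α {n} {a} {b} L0 U1 a≤ b≤ = decidable-stable (_ ≤? _) λ ab≰2n →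
  ¬¬-approximation α q {{q≢0}} L0 U1 λ (p , Lp , Up+2) → <⇒≱ (n<2^n q) (2^q≤n² p Lp Up+2 (≰⇒≥ ab≰2n))
  where
  -- The approximation loses a factor n², so any q with n² < 2 ^ q will do.
  q = n * n
  instance
    q≢0 : NonZero q
    q≢0 = m*n≢0 n n
  open ≤-Reasoning
  2^q≤n² : ∀ p → L α (pos p ℚ./ q) → U α (pos (2 + p) ℚ./ q) → 2 * n ≤ a * b → 2 ^ q ≤ n * n
  2^q≤n² p Lp Up+2 2n≤ab = *-cancelʳ-≤ (2 ^ q) (n * n) (n ^ q) {{m^n≢0 n q}} (begin
    2 ^ q * n ^ q              ≡⟨ ^-distribʳ-* q 2 n ⟨
    (2 * n) ^ q                ≤⟨ ^-monoˡ-≤ q 2n≤ab ⟩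
    (a * b) ^ q                ≡⟨ ^-distribʳ-* q a b ⟩
    a ^ q * b ^ q
      ≤⟨ *-mono-≤ (≤^ᴿ⁻ {a} {n} {1ℚ -ᴿ α} a≤ (q ∸ p) q (1-ᴿ-< α p q (q ∸ p) p+r≡q Lp))
                                           (≤^ᴿ⁻ {b} {n} {α} b≤ (2 + p) q (U⇒<ᴿ α Up+2)) ⟩
    n ^ (q ∸ p) * n ^ (2 + p)  ≡⟨ ^-distribˡ-+-* n (q ∸ p) (2 + p) ⟨
    n ^ (q ∸ p + (2 + p))      ≡⟨ cong (n ^_) (trans (move (q ∸ p) p) (cong (2 +_) p+r≡q)) ⟩
    n ^ (2 + q)                ≡⟨ *-assoc n n (n ^ q) ⟨
    n * n * n ^ q              ∎)
    where
    p+r≡q : p + (q ∸ p) ≡ q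
    p+r≡q = m+[n∸m]≡n (<⇒≤ (subst₂ _<_ (*-identityʳ p) (*-identityˡ q) (fraction-cancel-< p q 1 1 (L<U α Lp U1))))
    move : ∀ r p → r + (2 + p) ≡ 2 + (p + r)
    move = solve-∀

-- The exponent c / m = 1 - b / m is below 1 - α. If a ^ m ≤ n ^ c, comparing c / m with any p / q >
-- 1 - α gives a ^ q ≤ n ^ p, against the assumption on a.
≰^ᴿ⇒> : ∀ α {n a} b c m .{{_ : NonZero n}} .{{_ : NonZero m}} → U α (pos b ℚ./ m) → c + b ≡ m →
  ¬ (pos a ≤ n ^ᴿ (1ℚ -ᴿ α)) → n ^ c < a ^ m
≰^ᴿ⇒> α {n} {a} b c m Ub/m c+b≡m a≰ = ≰⇒> λ a^m≤n^c →
  a≰ (≤^ᴿ⁺ {a} {n} {1ℚ -ᴿ α} λ p q p/q →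
  ^-cancelˡ-≤ m (begin
    (a ^ q) ^ m ≡⟨ ^-*-assoc a q m ⟩
    a ^ (q * m) ≡⟨ cong (a ^_) (*-comm q m) ⟩
    a ^ (m * q) ≡⟨ ^-*-assoc a m q ⟨
    (a ^ m) ^ q ≤⟨ ^-monoˡ-≤ q a^m≤n^c ⟩
    (n ^ c) ^ q ≡⟨ ^-*-assoc n c q ⟩
    n ^ (c * q) ≤⟨ ^-monoʳ-≤ n (cq≤pm p q (exponent-sum α p q b m p/q (U⇒<ᴿ α Ub/m))) ⟩
    n ^ (p * m) ≡⟨ ^-*-assoc n p m ⟨
    (n ^ p) ^ m ∎))
  where
  open ≤-Reasoning
  cq≤pm : ∀ p q → q * m < p * m + b * q → c * q ≤ p * m
  cq≤pm p q qm< = +-cancelʳ-≤ (b * q) _ _ (begin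
    c * q + b * q ≡⟨ *-distribʳ-+ q c b ⟨
    (c + b) * q   ≡⟨ cong (_* q) c+b≡m ⟩
    m * q         ≡⟨ *-comm m q ⟩
    q * m         ≤⟨ <⇒≤ qm< ⟩
    p * m + b * q ∎)

-- This is where α < 1 / 2 enters: 2 b < m leaves b + 1 ≤ m - b, and the extra factor n between n ^
-- b and n ^ (m - b) absorbs K ^ m.
side-ratio : ∀ α {n A B K} b m .{{_ : NonZero n}} .{{_ : NonZero m}} → U α (pos b ℚ./ m) → b * 2 < m →
  pos B ≤ n ^ᴿ α → ¬ (pos (suc A) ≤ n ^ᴿ (1ℚ -ᴿ α)) → K ^ m ≤ n → K * B ≤ A
side-ratio α {n} {A} {B} {K} b m Ub/m 2b<m B≤ A+1≰ K^m≤n = s≤s⁻¹ (^-cancelˡ-< m (begin-strict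
  (K * B) ^ m   ≡⟨ ^-distribʳ-* m K B ⟩
  K ^ m * B ^ m ≤⟨ *-mono-≤ K^m≤n (≤^ᴿ⁻ {B} {n} {α} B≤ b m (U⇒<ᴿ α Ub/m)) ⟩
  n ^ suc b     ≤⟨ ^-monoʳ-≤ n 1+b≤m-b ⟩
  n ^ (m ∸ b)   <⟨ ≰^ᴿ⇒> α b (m ∸ b) m Ub/m (m∸n+n≡m (≤-trans (m≤n+m b (suc b)) 1+b+b≤m)) A+1≰ ⟩
  suc A ^ m     ∎))
  where
  open ≤-Reasoning
  1+b+b≤m : suc b + b ≤ m
  1+b+b≤m = subst (_< m) (double b) 2b<m
    where
    double : ∀ b → b * 2 ≡ b + b
    double = solve-∀
  1+b≤m-b : suc b ≤ m ∸ b
  1+b≤m-b = subst (_≤ m ∸ b) (m+n∸n≡m (suc b) b) (∸-monoˡ-≤ b 1+b+b≤m)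

-- Square roots and distances

-- The lower cut asks for a rational strictly above p / q whose square is at most m, and (p + 1) / q
-- serves.
L-√⁺ : ∀ m p q .{{_ : NonZero q}} → suc p * suc p ≤ m * (q * q) → L (√ m) (pos p ℚ./ q)
L-√⁺ m p q le = pos (suc p) ℚ./ q , fraction-mono-< p q (suc p) q (*-monoˡ-< q (n<1+n p)) ,
  subst (ℚ._≤ fromℕ m) (sym (fraction-*-homo (suc p) q (suc p) q))
    (fraction-mono-≤ (suc p * suc p) (q * q) m 1 {{m*n≢0 q q}} (subst (_≤ m * (q * q)) (sym (*-identityʳ _)) le))

L-√⁻ : ∀ m p q .{{_ : NonZero q}} → L (√ m) (pos p ℚ./ q) → p * p ≤ m * (q * q)
L-√⁻ m p q (r , p/q<r , r²≤m) = subst (_≤ m * (q * q)) (*-identityʳ (p * p))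
  (fraction-cancel-≤ (p * p) (q * q) m 1 {{m*n≢0 q q}}
    (subst (ℚ._≤ fromℕ m) (fraction-*-homo p q p q) (ℚ.≤-trans p/q²≤r² r²≤m)))
  where
  p/q = pos p ℚ./ q
  0≤p/q : 0ℚ ℚ.≤ p/q
  0≤p/q = fraction-mono-≤ 0 1 p q z≤n
  p/q²≤r² : p/q ℚ.* p/q ℚ.≤ r ℚ.* r
  p/q²≤r² = ℚ.≤-trans (ℚ.*-monoˡ-≤-nonNeg p/q {{ℚ.nonNegative 0≤p/q}} (ℚ.<⇒≤ p/q<r))
    (ℚ.*-monoʳ-≤-nonNeg r {{ℚ.nonNegative (ℚ.≤-trans 0≤p/q (ℚ.<⇒≤ p/q<r))}} (ℚ.<⇒≤ p/q<r))

-- If m' < m, any p / q ≤ √ m' would force (p + 1) / q ≤ √ m' for a fixed large q, hence p unbounded.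
√-cancel-≤ : ∀ {m m'} → (∀ q → L (√ m) q → L (√ m') q) → m ≤ m'
√-cancel-≤ {m} {m'} L⊆ = ≮⇒≥ λ m'<m → <⇒≱ too-big (climb m'<m (suc m' * q))
  where
  -- For p ≤ (m' + 1) q, the increase 4 p + 4 from p² to (p + 2)² is at most 4 (m' + 2) q, which
  -- this choice makes equal to q².
  q = 4 * (2 + m')
  open ≤-Reasoning

  too-big : m' * (q * q) < suc m' * q * (suc m' * q)
  too-big = begin-strict
    m' * (q * q)              <⟨ *-monoˡ-< (q * q) (n<1+n m') ⟩
    suc m' * (q * q)          ≤⟨ m≤n*m (suc m' * (q * q)) (suc m') ⟩
    suc m' * (suc m' * (q * q)) ≡⟨ regroup (suc m') q ⟩
    suc m' * q * (suc m' * q) ∎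
    where
    regroup : ∀ a q → a * (a * (q * q)) ≡ a * q * (a * q)
    regroup = solve-∀

  bounded : ∀ p → p * p ≤ m' * (q * q) → p ≤ suc m' * q
  bounded p le = ≮⇒≥ λ lt → <⇒≱ too-big (≤-trans (*-mono-≤ (<⇒≤ lt) (<⇒≤ lt)) le)

  step : m' < m → ∀ p → p * p ≤ m' * (q * q) → (2 + p) * (2 + p) ≤ m * (q * q)
  step m'<m p le = begin
    (2 + p) * (2 + p)               ≡⟨ expand p ⟩
    p * p + (4 * p + 4)
      ≤⟨ +-mono-≤ le (+-mono-≤ (*-monoʳ-≤ 4 (bounded p le)) (*-monoʳ-≤ 4 (>-nonZero⁻¹ q))) ⟩
    m' * (q * q) + (4 * (suc m' * q) + 4 * q) ≡⟨ collect m' q ⟩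
    q * q + m' * (q * q)            ≤⟨ *-monoˡ-≤ (q * q) m'<m ⟩
    m * (q * q)                     ∎
    where
    expand : ∀ p → (2 + p) * (2 + p) ≡ p * p + (4 * p + 4)
    expand = solve-∀
    collect : ∀ m q → m * (q * q) + (4 * ((1 + m) * q) + 4 * q) ≡ 4 * (2 + m) * q + m * (q * q)
    collect = solve-∀

  climb : m' < m → ∀ p → p * p ≤ m' * (q * q)
  climb m'<m zero    = z≤n
  climb m'<m (suc p) = L-√⁻ m' (suc p) q (L⊆ _ (L-√⁺ m (suc p) q (step m'<m p (climb m'<m p))))

√-injective : ∀ {m m'} → √ m ≈ᴿ √ m' → m ≡ m'
√-injective eq = ≤-antisym (√-cancel-≤ (Equivalence.to ∘ eq)) (√-cancel-≤ (Equivalence.from ∘ eq))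

√0≈0 : √ 0 ≈ᴿ fromℚ 0ℚ
√0≈0 q = mk⇔
  (λ (r , q<r , r²≤0) → ℚ.≰⇒> λ 0≤q → let 0<r = ℚ.≤-<-trans 0≤q q<r in
    ℚ.<-irrefl refl (ℚ.<-≤-trans
      (subst (ℚ._< r ℚ.* r) (ℚ.*-zeroʳ r) (ℚ.*-monoʳ-<-pos r {{ℚ.positive 0<r}} 0<r)) r²≤0))
  (λ q<0 → 0ℚ , q<0 , ℚ.≤-refl)

√≉0 : ∀ m .{{_ : NonZero m}} → ¬ √ m ≈ᴿ fromℚ 0ℚ
√≉0 m eq = ℚ.<-irrefl refl (Equivalence.to (eq 0ℚ)
  (L-√⁺ m 0 1 (≤-trans (>-nonZero⁻¹ m) (≤-reflexive (sym (*-identityʳ m))))))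

-- Maximal sides and the distances of the lattice

IsMaximum : ℕ → ℝ → ℕ → Set
IsMaximum n x A = pos A ≤ n ^ᴿ x × ¬ pos (suc A) ≤ n ^ᴿ x

module _ {n x A} (A-max : IsMaximum n x A) where
  ≤⇒≤^ᴿ : ∀ {i} → i ≤ A → pos i ≤ n ^ᴿ x
  ≤⇒≤^ᴿ i≤A = ≤^ᴿ-down {x = x} i≤A (proj₁ A-max)

  ≤^ᴿ⇒≤-maximum : ∀ {i} → pos i ≤ n ^ᴿ x → i ≤ A
  ≤^ᴿ⇒≤-maximum i≤ = ≮⇒≥ λ A<i → proj₂ A-max (≤^ᴿ-down {x = x} A<i i≤)

-- An exponent below 1 admits no integer above n, so the descent can start from n + 1.
¬¬-IsMaximum : ∀ n x .{{_ : NonZero n}} → x <ᴿ fromℚ 1ℚ → ¬ ¬ (∃[ A ] IsMaximum n x A)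
¬¬-IsMaximum n x x<1 = ¬¬-maximum {P = λ i → pos i ≤ n ^ᴿ x} (suc n)
  (≤^ᴿ-down {x = x} z≤n (1≤^ᴿ n x)) (1+n≰n ∘ ≤^ᴿ⇒≤ {suc n} {n} {x} x<1)

-- Both lists enumerate the same distances. Used in both directions, this carries bounds for one
-- enumeration over to any other.
DistinctDistances-≤ : ∀ {P D D'} → DistinctDistances P D → DistinctDistances P D' → D ≤ D'
DistinctDistances-≤ (ds , ds! , ds⇔ , refl) (ds' , _ , ds'⇔ , refl) =
  length-mono-injective ℝ-setoid ℝ-setoid id ds!
    (λ {d} d∈ → Equivalence.from (ds'⇔ d) (Equivalence.to (ds⇔ d) d∈)) (λ _ _ eq → eq)

module _ (α : ℝ) (n A B : ℕ) (A-max : IsMaximum n (1ℚ -ᴿ α) A) (B-max : IsMaximum n α B) where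

  ∣-∣-bound : ∀ {x A i k} → IsMaximum n x A → 0ℤ ℤ.≤ i × i ≤ n ^ᴿ x → 0ℤ ℤ.≤ k × k ≤ n ^ᴿ x →
    ∣ i ℤ.- k ∣ ≤ A
  ∣-∣-bound {x} {A} {pos i} {pos k} max (_ , i≤) (_ , k≤) =
    ≤-trans (≤-reflexive (cong ∣_∣ (ℤ.[+m]-[+n]≡m⊖n i k)))
      (≤-trans (ℤ.∣m⊝n∣≤m⊔n i k) (⊔-lub (≤^ᴿ⇒≤-maximum {n} {x} max i≤) (≤^ᴿ⇒≤-maximum {n} {x} max k≤)))

  -- Coordinates between 0 and a maximal side differ by at most that side, so every squared distance
  -- is a listed norm; conversely the norm of (x , y) is realised by its distance from the origin.
  norms-distances : DistinctDistances (Lattice α n) (length (norms A B))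
  norms-distances = map √ (norms A B)
    , UniqueSetoidₚ.map⁺ (setoid ℕ) ℝ-setoid √-injective (norms! A B)
    , (λ d → mk⇔ (is-distance {d} ∘ SetoidMembershipₚ.∈-map⁻ (setoid ℕ) ℝ-setoid {d}) (is-norm {d}))
    , length-map √ (norms A B)
    where
    ∣x-0∣≡x : ∀ x → ∣ pos x ℤ.- 0ℤ ∣ ≡ x
    ∣x-0∣≡x x = cong ∣_∣ (ℤ.+-identityʳ (pos x))

    is-distance : ∀ {d} → ∃[ m ] m ∈ norms A B × d ≈ᴿ √ m → IsNonzeroDistance (Lattice α n) d
    is-distance {d} (m , m∈ , d≈√m) = let m≢0 , x , y , x≤A , y≤B , m≡ = ∈-norms⁻ A B m∈ in
      (λ d≈0 → √≉0 m {{m≢0}} (≈ᴿ.trans {√ m} {d} {fromℚ 0ℚ} (≈ᴿ.sym {d} {√ m} d≈√m) d≈0))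
      , (pos x , pos y) , (0ℤ , 0ℤ)
      , ((+≤+ z≤n , ≤⇒≤^ᴿ {n} {1ℚ -ᴿ α} A-max x≤A) , (+≤+ z≤n , ≤⇒≤^ᴿ {n} {α} B-max y≤B))
      , ((+≤+ z≤n , ≤⇒≤^ᴿ {n} {1ℚ -ᴿ α} A-max z≤n) , (+≤+ z≤n , ≤⇒≤^ᴿ {n} {α} B-max z≤n))
      , subst (λ m → d ≈ᴿ √ m) (trans m≡ (sym (cong₂ (λ u v → norm (u , v)) (∣x-0∣≡x x) (∣x-0∣≡x y))))
          d≈√m

    is-norm : ∀ {d} → IsNonzeroDistance (Lattice α n) d → d ∈ᴿ map √ (norms A B)
    is-norm {d} (d≉0 , (i , j) , (k , l) , (i∈ , j∈) , (k∈ , l∈) , d≈) =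
      SetoidMembershipₚ.∈-resp-≈ ℝ-setoid {map √ (norms A B)} {√ m} {d} (≈ᴿ.sym {d} {√ m} d≈)
        (SetoidMembershipₚ.∈-map⁺ (setoid ℕ) ℝ-setoid
          (λ {m} {m'} eq → ≈ᴿ.reflexive {√ m} {√ m'} (cong √ eq))
          (∈-norms⁺ A B (∣-∣-bound {1ℚ -ᴿ α} A-max i∈ k∈) (∣-∣-bound {α} B-max j∈ l∈) m≢0))
      where
      m = norm (∣ i ℤ.- k ∣ , ∣ j ℤ.- l ∣)
      m≢0 : NonZero m
      m≢0 = ≢-nonZero λ m≡0 → d≉0 (≈ᴿ.trans {d} {√ 0} {fromℚ 0ℚ} (subst (λ m → d ≈ᴿ √ m) m≡0 d≈) √0≈0)

-- Linear bounds on the number of distances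

1≤maximum : ∀ {n x A} .{{_ : NonZero n}} → IsMaximum n x A → 1 ≤ A
1≤maximum {n} {x} A-max = ≤^ᴿ⇒≤-maximum {n} {x} A-max (1≤^ᴿ n x)

-- Enlarging a positive side by 1 at most doubles it. This reduces both n < (A + 1) (B + 1) and the
-- count of vectors with zero coordinates to A B.
suc*suc≤ : ∀ {A B} → 1 ≤ A → 1 ≤ B → suc A * suc B ≤ 4 * (A * B)
suc*suc≤ {A} {B} 1≤A 1≤B = ≤-trans
  (*-mono-≤ (+-monoˡ-≤ A 1≤A) (+-monoˡ-≤ B 1≤B)) (≤-reflexive (regroup A B))
  where
  regroup : ∀ A B → (A + A) * (B + B) ≡ 4 * (A * B)
  regroup = solve-∀

module _ (α : ℝ) (0<α : L α 0ℚ) (b m : ℕ) {{_ : NonZero m}} (α<b/m : U α (pos b ℚ./ m)) (2b<m : b * 2 < m) where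

  α<1 : U α 1ℚ
  α<1 = U-up α (fraction-mono-< b m 1 1 (begin-strict
    b * 1 ≤⟨ *-monoʳ-≤ b (s≤s z≤n) ⟩
    b * 2 <⟨ 2b<m ⟩
    m     ≡⟨ *-identityˡ m ⟨
    1 * m ∎)) α<b/m
    where open ≤-Reasoning

  ¬¬-maxima : ∀ n .{{_ : NonZero n}} →
    ¬ ¬ (∃[ A ] ∃[ B ] IsMaximum n (1ℚ -ᴿ α) A × IsMaximum n α B)
  ¬¬-maxima n k = ¬¬-IsMaximum n (1ℚ -ᴿ α) (1-ᴿ-< α 0 1 1 refl 0<α) λ (A , A-max) →
    ¬¬-IsMaximum n α (U⇒<ᴿ α α<1) λ (B , B-max) → k (A , B , A-max , B-max)

  -- With L the number of norms, both n and L are at most (A + 1) (B + 1) ≤ 4 A B, while A B is at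
  -- most 2 L and at most 2 n; hence the constant 8 on both sides.
  norms-bounds : ∀ {n A B} → 2 ^ (128 * (m * m)) ≤ n → IsMaximum n (1ℚ -ᴿ α) A → IsMaximum n α B →
    n ≤ 8 * length (norms A B) × length (norms A B) ≤ 8 * n
  norms-bounds {n} {A} {B} n≥ A-max B-max = lower , upper
    where
    instance
      n≢0 : NonZero n
      n≢0 = >-nonZero (≤-trans (m^n>0 2 (128 * (m * m))) n≥)
    sides≤ : suc A * suc B ≤ 4 * (A * B)
    sides≤ = suc*suc≤ (1≤maximum {n} {1ℚ -ᴿ α} A-max) (1≤maximum {n} {α} B-max)

    AB≤2norms : A * B ≤ 2 * length (norms A B)
    -- Since α < 1 gives B ≤ n, the scale k chosen for n also satisfies 2 B < 2 ^ k.
    AB≤2norms = let k , 2n<2^k , K^m≤n = log-scale m n≥ in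
      length-norms-≥ k (≤-<-trans (*-monoʳ-≤ 2 (≤^ᴿ⇒≤ {B} {n} {α} (U⇒<ᴿ α α<1) (proj₁ B-max))) 2n<2^k)
        (side-ratio α {n} {A} {B} {8 * k ^ 2} b m α<b/m 2b<m (proj₁ B-max) (proj₂ A-max) K^m≤n)

    open ≤-Reasoning
    lower : n ≤ 8 * length (norms A B)
    lower = begin
      n                             ≤⟨ <⇒≤ (*-lower-bound α {n} {suc A} {suc B} (proj₂ A-max) (proj₂ B-max)) ⟩
      suc A * suc B                 ≤⟨ sides≤ ⟩
      4 * (A * B)                   ≤⟨ *-monoʳ-≤ 4 AB≤2norms ⟩
      4 * (2 * length (norms A B))  ≡⟨ *-assoc 4 2 (length (norms A B)) ⟨
      8 * length (norms A B)        ∎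

    upper : length (norms A B) ≤ 8 * n
    upper = begin
      length (norms A B) ≤⟨ length-norms-≤ A B ⟩
      suc A * suc B      ≤⟨ sides≤ ⟩
      4 * (A * B)        ≤⟨ *-monoʳ-≤ 4 (*-upper-bound α {n} {A} {B} 0<α α<1 (proj₁ A-max) (proj₁ B-max)) ⟩
      4 * (2 * n)        ≡⟨ *-assoc 4 2 n ⟨
      8 * n              ∎

  -- The bounds on D are decidable, so the maximal sides may be assumed to exist; the given
  -- enumeration is then compared with the list of norms.
  distances-bounds : ∀ {n D} → 2 ^ (128 * (m * m)) ≤ n → DistinctDistances (Lattice α n) D →
    n ≤ 8 * D × D ≤ 8 * n
  distances-bounds {n} {D} n≥ distances = decidable-stable ((n ≤? 8 * D) ×-dec (D ≤? 8 * n)) λ ¬bounds →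
    ¬¬-maxima n {{>-nonZero (≤-trans (m^n>0 2 (128 * (m * m))) n≥)}} λ (A , B , A-max , B-max) →
      let canonical = norms-distances α n A B A-max B-max
          n≤ , ≤n   = norms-bounds n≥ A-max B-max
      in ¬bounds (≤-trans n≤ (*-monoʳ-≤ 8 (DistinctDistances-≤ canonical distances)) ,
                  ≤-trans (DistinctDistances-≤ distances canonical) ≤n)

theorem2p1 : ∀ (α : ℝ) → fromℚ 0ℚ <ᴿ α → α <ᴿ fromℚ ½ →
    ∃[ c ] ∃[ C ] ∃[ n₀ ] (0ℚ ℚ.< c) × (0ℚ ℚ.< C) ×
    (∀ (n : ℕ) → n₀ ℕ.≤ n →
    (¬ ¬ (∃[ D ] DistinctDistances (Lattice α n) D)) ×
    (∀ (D : ℕ) → DistinctDistances (Lattice α n) D →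
    (c ℚ.* fromℕ n ℚ.≤ fromℕ D) × (fromℕ D ℚ.≤ C ℚ.* fromℕ n)))
theorem2p1 α (q , 0<q , Lq) (r , Ur , r<½)
  with b , m , m≢0 , refl ← positive-fraction r (ℚ.<-trans 0<q (L<U α Lq Ur)) =
  -- Both constants are absolute. Only the threshold depends on α, through the denominator m of a
  -- rational b / m between α and 1 / 2.
  pos 1 ℚ./ 8 , pos 8 ℚ./ 1 , 2 ^ (128 * (m * m)) , ℚ.positive⁻¹ _ , ℚ.positive⁻¹ _ , λ n n≥ →
    (λ none → ¬¬-maxima α L0 b m Ur 2b<m n {{>-nonZero (≤-trans (m^n>0 2 (128 * (m * m))) n≥)}}
      λ (A , B , A-max , B-max) → none (_ , norms-distances α n A B A-max B-max)) ,
    λ D distances → let n≤8D , D≤8n = distances-bounds α L0 b m Ur 2b<m n≥ distances in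
      subst (ℚ._≤ fromℕ D) (sym (fraction-*-homo 1 8 n 1))
        (fraction-mono-≤ (1 * n) 8 D 1 (subst₂ _≤_ (sym (trans (*-identityʳ _) (*-identityˡ n))) (*-comm 8 D) n≤8D)) ,
      subst (fromℕ D ℚ.≤_) (sym (fraction-*-homo 8 1 n 1))
        (fraction-mono-≤ D 1 (8 * n) 1 (*-monoˡ-≤ 1 D≤8n))
  where
  instance _ = m≢0
  L0 : L α 0ℚ
  L0 = L-down α 0<q Lq
  2b<m : b * 2 < m
  2b<m = subst (b * 2 <_) (*-identityˡ m) (fraction-cancel-< b m 1 2 r<½)
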